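{- Let $\mathcal{H}$ be a family of graphs. There are two constants $c_1=c_1(\mathcal{H})$, $c_2=c_2(\mathcal{H})$ such that $$\#\{v\in V(G):\deg(v)\ge c_1\}<c_2$$ for every $\mathcal{H}$-free graph $G$ if and only if $$\mathcal{H}\le\{K_n,\ K_{n,n},\ nK_{1,n}\}$$ for some positive integer $n$.
   Context: All graphs are finite, undirected and simple. For graphs $H_1,H_2$, write $H_1\le H_2$ if $H_1$ is (isomorphic to) an induced subgraph of $H_2$. A graph $G$ is $\mathcal{H}$-free if there is no $H\in\mathcal{H}$ with $H\le G$. For families of graphs $\mathcal{H}_1,\mathcal{H}_2$, write $\mathcal{H}_1\le\mathcal{H}_2$ if for every $H_2\in\mathcal{H}_2$ there is $H_1\in\mathcal{H}_1$ with $H_1\le H_2$. $K_n$ is the complete graph on $n$ vertices, $K_{s,t}$ the complete bipartite graph, and $nG$ the disjoint union of $n$ copies of $G$. -}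

module Defs where

open import Level using (Level; 0ℓ; suc; _⊔_)
open import Data.Bool.Base using (Bool; true; false; not; _∧_; _xor_)
open import Data.Bool.Properties using (xor-comm; xor-same; ∧-zeroʳ)
open import Data.Fin.Base using (Fin; splitAt; quotient; remainder)
open import Data.Fin.Properties using (_≟_)
open import Data.Fin.Subset using (Subset; ∣_∣)
open import Data.List.Base using (List)
open import Data.List.Membership.Propositional using (_∈_)
open import Data.Nat.Base using (ℕ; _+_; _*_)
open import Data.Nat.Properties using (_≤?_)
open import Data.Product.Base using (_×_; ∃-syntax)
open import Data.Sum.Base using ([_,_]′)
open import Data.Vec.Base using (tabulate)
open import Function.Base using (const)
open import Function.Bundles using (mk⇔)
open import Function.Definitions using (Injective)
open import Relation.Binary.PropositionalEquality
  using (_≡_; refl; sym; cong; cong₂; trans)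
open import Relation.Nullary using (¬_; does)
open import Relation.Nullary.Decidable using (dec-true; does-⇔)
open import Relation.Unary using (Pred)

-- A finite simple graph, with its vertices numbered 0, …, order − 1.
record Graph : Set where
  field
    order       : ℕ
    adjacent    : Fin order → Fin order → Bool
    symmetric   : ∀ u v → adjacent u v ≡ adjacent v u
    irreflexive : ∀ v → adjacent v v ≡ false

open Graph public

neighbours : (G : Graph) → Fin (order G) → Subset (order G)
neighbours G v = tabulate (adjacent G v)

degree : (G : Graph) → Fin (order G) → ℕ
degree G v = ∣ neighbours G v ∣

verticesOfDegree≥ : ℕ → (G : Graph) → Subset (order G)
verticesOfDegree≥ c G = tabulate λ v → does (c ≤? degree G v)

infix 4 _⊑_ _≼_

-- H is isomorphic to an induced subgraph of G: the map f is an isomorphism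
-- onto the subgraph of G induced by the image of f.
_⊑_ : Graph → Graph → Set
H ⊑ G =
  ∃[ f ] Injective _≡_ _≡_ f ×
         (∀ u v → adjacent H u v ≡ adjacent G (f u) (f v))

-- Families need not be finite, decidable or closed under isomorphism.
Family : (ℓ : Level) → Set (suc ℓ)
Family ℓ = Pred Graph ℓ

Free : ∀ {ℓ} → Family ℓ → Graph → Set ℓ
Free ℋ G = ¬ (∃[ H ] ℋ H × H ⊑ G)

_≼_ : ∀ {ℓ₁ ℓ₂} → Family ℓ₁ → Family ℓ₂ → Set (ℓ₁ ⊔ ℓ₂)
ℋ₁ ≼ ℋ₂ = ∀ H₂ → ℋ₂ H₂ → ∃[ H₁ ] ℋ₁ H₁ × H₁ ⊑ H₂

K : ℕ → Graph
K n = record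
  { order       = n
  ; adjacent    = λ u v → not (does (u ≟ v))
  ; symmetric   = λ u v → cong not (does-⇔ (mk⇔ sym sym) (u ≟ v) (v ≟ u))
  ; irreflexive = λ v → cong not (dec-true (v ≟ v) refl)
  }

-- The first s vertices form one side, the remaining t the other.
K⟨_,_⟩ : ℕ → ℕ → Graph
K⟨ s , t ⟩ = record
  { order       = s + t
  ; adjacent    = λ u v → side u xor side v
  ; symmetric   = λ u v → xor-comm (side u) (side v)
  ; irreflexive = λ v → xor-same (side v)
  }
  where
  side : Fin (s + t) → Bool
  side v = [ const true , const false ]′ (splitAt s v)

-- The disjoint union of n copies of G. The vertices are identified with pairs
-- of a copy (quotient) and a vertex of G (remainder).
copies : ℕ → Graph → Graph
copies n G = record
  { order       = n * order G
  ; adjacent    = λ u v → does (copy u ≟ copy v) ∧ adjacent G (vertex u) (vertex v)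
  ; symmetric   = λ u v → cong₂ _∧_ (does-⇔ (mk⇔ sym sym) (copy u ≟ copy v) (copy v ≟ copy u))
                                    (symmetric G (vertex u) (vertex v))
  ; irreflexive = λ v → trans (cong (does (copy v ≟ copy v) ∧_)
                                    (irreflexive G (vertex v)))
                              (∧-zeroʳ _)
  }
  where
  copy : Fin (n * order G) → Fin n
  copy = quotient (order G)

  vertex : Fin (n * order G) → Fin (order G)
  vertex = remainder {n} (order G)

⟦_⟧ : List Graph → Family 0ℓ
⟦ Gs ⟧ G = G ∈ Gs

{-# OPTIONS --safe #-}

-- Among many vertices of large degree one greedily chooses pairwise disjoint
-- induced stars K_{1,n}; this can only fail if a neighbourhood contains K_n.
-- For positions a, b in the star, colour a pair i < j of stars by whether the
-- a-th vertex of star i is adjacent to the b-th vertex of star j. Ramsey's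
-- theorem, once for each (a , b), leaves 2n stars on which all these colours are
-- constant. A colour "adjacent" with a = b yields K_n, one with a ≠ b yields
-- K_{n,n}, and if there is none, the stars form n K_{1,n}.
module Submission where

open import Defs
open import Level using (Level; 0ℓ)
open import Axiom.ExcludedMiddle using (ExcludedMiddle)
open import Axiom.DoubleNegationElimination using (em⇒dne)
open import Data.Bool.Base using (Bool; true; false; not; _∧_)
import Data.Bool.Properties as Bool
open import Data.Empty using (⊥)
open import Data.Fin.Base as Fin
  using (Fin; zero; suc; inject≤; splitAt; join; combine; remQuot; punchIn; _↑ˡ_; _↑ʳ_)
open import Data.Fin.Properties as Fin
  using (any?; injective⇒≤; <-cmp; toℕ-inject≤; toℕ-↑ˡ; toℕ-↑ʳ; toℕ<n; join-splitAt;
         splitAt-↑ˡ; splitAt-↑ʳ; ↑ˡ-injective; ↑ʳ-injective; punchInᵢ≢i; punchIn-injective;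
         combine-remQuot; remQuot-combine; combine-injectiveˡ; combine-injectiveʳ)
open import Data.Fin.Subset using (∣_∣)
open import Data.List.Base
  using (List; []; _∷_; _++_; length; filter; lookup; tabulate; allFin; take)
open import Data.List.Properties using (length-++; length-tabulate; length-take)
open import Data.List.Membership.DecPropositional using (_∈?_)
open import Data.List.Membership.Propositional using (_∈_; _∉_)
open import Data.List.Membership.Propositional.Properties
  using (∈-filter⁺; ∈-filter⁻; ∈-++⁺ˡ; ∈-++⁺ʳ; ∈-++⁻; ∈-tabulate⁺; ∈-tabulate⁻; ∈-allFin; ∈-lookup)
open import Data.List.Relation.Binary.Sublist.Propositional
  using (_⊆_; []; _∷_; _∷ʳ_; ⊆-refl; ⊆-trans; minimum)
  renaming (lookup to ∈-resp-⊆)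
open import Data.List.Relation.Binary.Sublist.Propositional.Properties
  using (All-resp-⊆; filter-⊆; take-⊆)
open import Data.List.Relation.Unary.All as All using (All; []; _∷_)
open import Data.List.Relation.Unary.All.Properties using (all-filter)
open import Data.List.Relation.Unary.AllPairs using (AllPairs; []; _∷_)
open import Data.List.Relation.Unary.Any using (here; there; index)
open import Data.List.Relation.Unary.Any.Properties using (lookup-index)
open import Data.List.Relation.Unary.Unique.Propositional using (Unique)
open import Data.List.Relation.Unary.Unique.Propositional.Properties
  using (allFin⁺; filter⁺; tabulate⁺; Unique[x∷xs]⇒x∉xs)
open import Data.Nat.Base using (ℕ; zero; suc; _+_; _*_; _≤_; _<_; _≥_; z≤n; s≤s)
open import Data.Nat.Properties
  using (≤-reflexive; ≤-trans; <-≤-trans; +-monoˡ-≤; +-monoʳ-≤; +-monoʳ-<; +-cancelˡ-≤; +-assoc; +-comm;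
         +-suc; m≤m+n; m≤n+m; m≤m*n; n≤1+n; m≤n⇒m≤1+n; ≰⇒>; <⇒≱; _≤?_; m≤n⇒m⊓n≡m; module ≤-Reasoning)
open import Data.Product.Base using (_×_; _,_; proj₁; proj₂; ∃-syntax; Σ-syntax; uncurry)
open import Data.Sum.Base using (_⊎_; inj₁; inj₂; [_,_]′)
import Data.Vec.Base as Vec
import Data.Vec.Functional as Vector
open import Function.Base using (_∘_; const; id)
open import Function.Bundles using (_⇔_; mk⇔)
open import Function.Definitions using (Injective)
open import Relation.Binary.Core using (Rel)
open import Relation.Binary.Definitions using (Symmetric; tri<; tri≈; tri>)
open import Relation.Binary.PropositionalEquality
  using (_≡_; _≢_; refl; sym; trans; cong; cong₂; subst; subst₂)
open import Relation.Nullary using (Dec; ¬_; yes; no; does; contradiction)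
open import Relation.Nullary.Decidable using (dec-true; dec-false; ¬?)

private variable
  A : Set
  k m n : ℕ

-- Lists and counting

AllPairs-resp-⊆ : {R : Rel A 0ℓ} {xs ys : List A} → xs ⊆ ys → AllPairs R ys → AllPairs R xs
AllPairs-resp-⊆ []         []       = []
AllPairs-resp-⊆ (_ ∷ʳ p)   (_ ∷ rs) = AllPairs-resp-⊆ p rs
AllPairs-resp-⊆ (refl ∷ p) (r ∷ rs) = All-resp-⊆ p r ∷ AllPairs-resp-⊆ p rs

AllPairs-lookup : {R : Rel A 0ℓ} {xs : List A} → AllPairs R xs →
                  ∀ {i j} → i Fin.< j → R (lookup xs i) (lookup xs j)
AllPairs-lookup {xs = _ ∷ xs} (r ∷ rs) {zero}  {suc j} _         = All.lookup r (∈-lookup {xs = xs} j)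
AllPairs-lookup {xs = _ ∷ xs} (r ∷ rs) {suc i} {suc j} (s≤s i<j) = AllPairs-lookup rs i<j

-- Ramsey arguments return lists with at least `k` entries, while the target graphs have exactly `k`
-- vertices; the surplus is dropped here.
select : (xs : List A) → k ≤ length xs → Fin k → A
select xs k≤ i = lookup xs (inject≤ i k≤)

select-∈ : {xs : List A} (k≤ : k ≤ length xs) (i : Fin k) → select xs k≤ i ∈ xs
select-∈ {xs = xs} k≤ i = ∈-lookup {xs = xs} (inject≤ i k≤)

AllPairs-select : {R : Rel A 0ℓ} {xs : List A} → AllPairs R xs → (k≤ : k ≤ length xs) →
                  ∀ {i j : Fin k} → i Fin.< j → R (select xs k≤ i) (select xs k≤ j)
AllPairs-select rs k≤ {i} {j} i<j =
  AllPairs-lookup rs (subst₂ _<_ (sym (toℕ-inject≤ i k≤)) (sym (toℕ-inject≤ j k≤)) i<j)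

-- `AllPairs` controls a pair of entries only in list order; for a symmetric relation trichotomy
-- supplies the other order.
offDiagonal : {R : Rel A 0ℓ} → Symmetric R → (f : Fin k → A) →
              (∀ {i j} → i Fin.< j → R (f i) (f j)) → ∀ {i j} → i ≢ j → R (f i) (f j)
offDiagonal R-sym f r {i} {j} i≢j with <-cmp i j
... | tri< i<j _ _ = r i<j
... | tri≈ _ i≡j _ = contradiction i≡j i≢j
... | tri> _ _ j<i = R-sym (r j<i)

≢⇒injective : (f : Fin k → A) → (∀ {i j} → i ≢ j → f i ≢ f j) → Injective _≡_ _≡_ f
≢⇒injective f f≢ {i} {j} eq with i Fin.≟ j
... | yes i≡j = i≡j
... | no  i≢j = contradiction eq (f≢ i≢j)

Unique⇒select-injective : {xs : List A} → Unique xs → (k≤ : k ≤ length xs) →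
                          Injective _≡_ _≡_ (select xs k≤)
Unique⇒select-injective {xs = xs} xs! k≤ =
  ≢⇒injective (select xs k≤) (offDiagonal {R = _≢_} (_∘ sym) (select xs k≤) (AllPairs-select xs! k≤))

-- Sending each index of `xs` to a position of its entry in `ys` is injective because `xs` has no
-- repetition, so the pigeonhole principle applies.
Unique-length-≤ : {xs ys : List A} → Unique xs → (∀ {x} → x ∈ xs → x ∈ ys) →
                  length xs ≤ length ys
Unique-length-≤ {xs = xs} {ys} xs! xs⊆ys = injective⇒≤ {f = position} position-injective
  where
  member : ∀ i → lookup xs i ∈ ys
  member i = xs⊆ys (∈-lookup {xs = xs} i)

  position : Fin (length xs) → Fin (length ys)
  position i = index (member i)

  position-injective : Injective _≡_ _≡_ position
  position-injective {i} {j} eq =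
    ≢⇒injective (lookup xs) (offDiagonal {R = _≢_} (_∘ sym) (lookup xs) (AllPairs-lookup xs!))
      (trans (lookup-index (member i)) (trans (cong (lookup ys) eq) (sym (lookup-index (member j)))))

does-true⇒ : {P : Set} (P? : Dec P) → does P? ≡ true → P
does-true⇒ (yes p) _ = p

module _ {n : ℕ} where

  infixl 6 _∖_

  _∖_ : List (Fin n) → List (Fin n) → List (Fin n)
  xs ∖ ys = filter (λ x → ¬? (_∈?_ Fin._≟_ x ys)) xs

  length-∖ : {xs : List (Fin n)} (ys : List (Fin n)) → Unique xs →
             length xs ≤ length ys + length (xs ∖ ys)
  length-∖ {xs} ys xs! = ≤-trans (Unique-length-≤ xs! covered) (≤-reflexive (length-++ ys))
    where
    covered : ∀ {x} → x ∈ xs → x ∈ ys ++ (xs ∖ ys)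
    covered {x} x∈xs with _∈?_ Fin._≟_ x ys
    ... | yes x∈ys = ∈-++⁺ˡ x∈ys
    ... | no  x∉ys = ∈-++⁺ʳ ys (∈-filter⁺ _ x∈xs x∉ys)

  satisfying : (Fin n → Bool) → List (Fin n)
  satisfying p = filter (λ v → p v Bool.≟ true) (allFin n)

  satisfying-unique : ∀ p → Unique (satisfying p)
  satisfying-unique p = filter⁺ _ (allFin⁺ n)

  ∈-satisfying⁻ : ∀ p {v} → v ∈ satisfying p → p v ≡ true
  ∈-satisfying⁻ p v∈ = proj₂ (∈-filter⁻ (λ v → p v Bool.≟ true) {xs = allFin n} v∈)

-- The function `f` is general so that the induction can pass to `f ∘ suc`; the case of interest is
-- `f = id`.
count-tabulate : (p : A → Bool) (f : Fin n → A) →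
  ∣ Vec.tabulate (p ∘ f) ∣ ≡ length (filter (λ x → p x Bool.≟ true) (tabulate f))
count-tabulate {n = zero}  p f = refl
count-tabulate {n = suc n} p f with p (f zero)
... | true  = cong suc (count-tabulate p (f ∘ suc))
... | false = count-tabulate p (f ∘ suc)

count-satisfying : (p : Fin n → Bool) → ∣ Vec.tabulate p ∣ ≡ length (satisfying p)
count-satisfying p = count-tabulate p id

injection⇒≤-count : (p : Fin n → Bool) {f : Fin k → Fin n} → Injective _≡_ _≡_ f →
                    (∀ i → p (f i) ≡ true) → k ≤ ∣ Vec.tabulate p ∣
injection⇒≤-count {n} {k} p {f} f-inj pf = begin
  k                       ≡⟨ length-tabulate f ⟨
  length (tabulate f)     ≤⟨ Unique-length-≤ (tabulate⁺ f-inj) member ⟩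
  length (satisfying p)   ≡⟨ count-satisfying p ⟨
  ∣ Vec.tabulate p ∣      ∎
  where
  open ≤-Reasoning
  member : ∀ {x} → x ∈ tabulate f → x ∈ satisfying p
  member x∈ with i , refl ← ∈-tabulate⁻ x∈ = ∈-filter⁺ _ (∈-allFin (f i)) (pf i)

-- Ramsey's theorem

Monochromatic : (A → A → Bool) → Bool → List A → Set
Monochromatic R c = AllPairs (λ x y → R x y ≡ c)

MonochromaticSublist : (A → A → Bool) → Bool → ℕ → List A → Set
MonochromaticSublist R c k xs = ∃[ ys ] ys ⊆ xs × k ≤ length ys × Monochromatic R c ys

-- A crude form of the Erdős-Szekeres recurrence, in which the extra one counts the pivot.
ramseyNumber : ℕ → ℕ → ℕ
ramseyNumber zero    b       = 0
ramseyNumber (suc a) zero    = 0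
ramseyNumber (suc a) (suc b) = suc (ramseyNumber a (suc b) + ramseyNumber (suc a) b)

module _ (R : A → A → Bool) where

  successors : Bool → A → List A → List A
  successors c x = filter (λ y → R x y Bool.≟ c)

  length-successors : ∀ x ys →
    length ys ≡ length (successors true x ys) + length (successors false x ys)
  length-successors x []       = refl
  length-successors x (y ∷ ys) with R x y
  ... | true  = cong suc (length-successors x ys)
  ... | false = trans (cong suc (length-successors x ys)) (sym (+-suc _ _))

  extend : ∀ c {x xs} → MonochromaticSublist R c k (successors c x xs) →
           MonochromaticSublist R c (suc k) (x ∷ xs)
  extend c {x} {xs} (ys , ys⊆ , k≤ , mono) =
    x ∷ ys , refl ∷ ⊆-trans ys⊆ (filter-⊆ _ xs) , s≤s k≤ ,
    All-resp-⊆ ys⊆ (all-filter (λ y → R x y Bool.≟ c) xs) ∷ mono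

  weaken : ∀ c {c′ x xs} → MonochromaticSublist R c′ k (successors c x xs) →
           MonochromaticSublist R c′ k (x ∷ xs)
  weaken c {x = x} {xs} (ys , ys⊆ , rest) = ys , x ∷ʳ ⊆-trans ys⊆ (filter-⊆ _ xs) , rest

  -- The head `x` is the pivot. Its successors split by colour, and one of the two classes is long
  -- enough for the induction; a sublist of the pivot's own colour is extended by `x`. A pair is
  -- coloured in list order, so `R` may be asymmetric, as it is for the colourings of pairs of
  -- stars.
  ramsey : ∀ a b xs → ramseyNumber a b ≤ length xs →
           MonochromaticSublist R true a xs ⊎ MonochromaticSublist R false b xs
  ramsey zero    b       xs       _ = inj₁ ([] , minimum xs , z≤n , [])
  ramsey (suc a) zero    xs       _ = inj₂ ([] , minimum xs , z≤n , [])
  ramsey (suc a) (suc b) (x ∷ xs) (s≤s r≤) with ramseyNumber a (suc b) ≤? length (successors true x xs)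
  ... | yes r₁≤ = [ inj₁ ∘ extend true , inj₂ ∘ weaken true ]′ (ramsey a (suc b) (successors true x xs) r₁≤)
  ... | no  r₁≰ = [ inj₁ ∘ weaken false , inj₂ ∘ extend false ]′ (ramsey (suc a) b (successors false x xs) r₂≤)
    where
    open ≤-Reasoning
    r₂≤ : ramseyNumber (suc a) b ≤ length (successors false x xs)
    r₂≤ = +-cancelˡ-≤ (ramseyNumber a (suc b)) _ _ (begin
      ramseyNumber a (suc b) + ramseyNumber (suc a) b                 ≤⟨ r≤ ⟩
      length xs                                                       ≡⟨ length-successors x xs ⟩
      length (successors true x xs) + length (successors false x xs)  ≤⟨ +-monoˡ-≤ _ (≤-trans (n≤1+n _) (≰⇒> r₁≰)) ⟩
      ramseyNumber a (suc b) + length (successors false x xs)         ∎)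

  diagonalRamsey : ∀ k xs → ramseyNumber k k ≤ length xs → ∃[ c ] MonochromaticSublist R c k xs
  diagonalRamsey k xs r≤ = [ (true ,_) , (false ,_) ]′ (ramsey k k xs r≤)

iteratedRamseyNumber : ℕ → ℕ → ℕ
iteratedRamseyNumber zero    k = k
iteratedRamseyNumber (suc m) k = iteratedRamseyNumber m (ramseyNumber k k)

-- Colouring `zero` is treated last, on a list where all others are already constant. They remain so
-- on sublists, so that list only has to have length `ramseyNumber k k`.
iteratedRamsey : ∀ m (R : Fin m → A → A → Bool) k xs → iteratedRamseyNumber m k ≤ length xs →
  Σ[ c ∈ (Fin m → Bool) ] ∃[ ys ] ys ⊆ xs × k ≤ length ys × (∀ p → Monochromatic (R p) (c p) ys)
iteratedRamsey zero    R k xs k≤ = (λ ()) , xs , ⊆-refl , k≤ , λ ()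
iteratedRamsey (suc m) R k xs r≤
  with c , ys , ys⊆xs , r′≤ , mono ← iteratedRamsey m (R ∘ suc) (ramseyNumber k k) xs r≤
  with c₀ , zs , zs⊆ys , k≤ , mono₀ ← diagonalRamsey (R zero) k ys r′≤
  = (c₀ Vector.∷ c) , zs , ⊆-trans zs⊆ys ys⊆xs , k≤ ,
    λ { zero → mono₀ ; (suc p) → AllPairs-resp-⊆ zs⊆ys (mono p) }

-- Induced subgraphs

⊑-trans : ∀ {G₁ G₂ G₃} → G₁ ⊑ G₂ → G₂ ⊑ G₃ → G₁ ⊑ G₃
⊑-trans (f , f-inj , f-adj) (g , g-inj , g-adj) =
  g ∘ f , f-inj ∘ g-inj , λ u v → trans (f-adj u v) (g-adj (f u) (f v))

copies-adjacent : ∀ H (i : Fin n) a j b →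
  adjacent (copies n H) (combine i a) (combine j b) ≡ does (i Fin.≟ j) ∧ adjacent H a b
copies-adjacent H i a j b =
  cong₂ (λ u v → does (proj₁ u Fin.≟ proj₁ v) ∧ adjacent H (proj₂ u) (proj₂ v))
        (remQuot-combine i a) (remQuot-combine j b)

module _ (G : Graph) where

  private
    V = Fin (order G)
    adj = adjacent G

  adjacent-sym : ∀ {c} → Symmetric (λ u v → adj u v ≡ c)
  adjacent-sym {x = u} {v} eq = trans (symmetric G v u) eq

  adjacent⇒≢ : ∀ {u v} → adj u v ≡ true → u ≢ v
  adjacent⇒≢ {u} eq refl with () ← trans (sym eq) (irreflexive G u)

  -- Injectivity comes from the edges: adjacent vertices are distinct.
  clique⇒K : {f : Fin k → V} → (∀ {i j} → i Fin.< j → adj (f i) (f j) ≡ true) → K k ⊑ G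
  clique⇒K {f = f} clique = f , ≢⇒injective f (λ i≢j → adjacent⇒≢ (edge i≢j)) , preserves
    where
    edge : ∀ {i j} → i ≢ j → adj (f i) (f j) ≡ true
    edge = offDiagonal {R = λ u v → adj u v ≡ true} adjacent-sym f clique

    preserves : ∀ i j → not (does (i Fin.≟ j)) ≡ adj (f i) (f j)
    preserves i j with i Fin.≟ j
    ... | yes refl = sym (irreflexive G (f i))
    ... | no  i≢j  = sym (edge i≢j)

  independent : {f : Fin k → V} → (∀ {i j} → i Fin.< j → adj (f i) (f j) ≡ false) →
                ∀ i j → adj (f i) (f j) ≡ false
  independent {f = f} f-ind i j with i Fin.≟ j
  ... | yes refl = irreflexive G (f i)
  ... | no  i≢j  = offDiagonal {R = λ u v → adj u v ≡ false} adjacent-sym f f-ind i≢j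

  -- The two sides cannot share a vertex, because it would be adjacent to itself. Together with the
  -- injectivity of `f` and `g` this makes the combined map injective.
  completeBipartite : {f : Fin m → V} {g : Fin n → V} →
    Injective _≡_ _≡_ f → Injective _≡_ _≡_ g →
    (∀ i j → adj (f i) (f j) ≡ false) → (∀ i j → adj (g i) (g j) ≡ false) →
    (∀ i j → adj (f i) (g j) ≡ true) → K⟨ m , n ⟩ ⊑ G
  completeBipartite {m} {n} {f} {g} f-inj g-inj f-ind g-ind edge =
    [ f , g ]′ ∘ splitAt m , splitAt-injective ∘ sum-injective _ _ , preserves
    where
    splitAt-injective : ∀ {u v} → splitAt m u ≡ splitAt m v → u ≡ v
    splitAt-injective {u} {v} eq =
      trans (sym (join-splitAt m n u)) (trans (cong (join m n) eq) (join-splitAt m n v))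

    sum-injective : ∀ x y → [ f , g ]′ x ≡ [ f , g ]′ y → x ≡ y
    sum-injective (inj₁ i) (inj₁ j) eq = cong inj₁ (f-inj eq)
    sum-injective (inj₁ i) (inj₂ j) eq = contradiction eq (adjacent⇒≢ (edge i j))
    sum-injective (inj₂ i) (inj₁ j) eq = contradiction (sym eq) (adjacent⇒≢ (edge j i))
    sum-injective (inj₂ i) (inj₂ j) eq = cong inj₂ (g-inj eq)

    preserves : ∀ u v → adjacent K⟨ m , n ⟩ u v ≡ adj ([ f , g ]′ (splitAt m u)) ([ f , g ]′ (splitAt m v))
    preserves u v with splitAt m u | splitAt m v
    ... | inj₁ i | inj₁ j = sym (f-ind i j)
    ... | inj₁ i | inj₂ j = sym (edge i j)
    ... | inj₂ i | inj₁ j = sym (adjacent-sym (edge j i))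
    ... | inj₂ i | inj₂ j = sym (g-ind i j)

  Disjoint : ∀ H → H ⊑ G → H ⊑ G → Set
  Disjoint _ (f , _) (g , _) = ∀ a b → f a ≢ g b

  Anticomplete : ∀ H → H ⊑ G → H ⊑ G → Set
  Anticomplete _ (f , _) (g , _) = ∀ a b → adj (f a) (g b) ≡ false

  -- Disjointness is assumed besides anticompleteness because `adj` is false on the diagonal, so
  -- that anticomplete images may still overlap.
  disjointCopies : ∀ H (e : Fin n → H ⊑ G) →
    (∀ {i j} → i ≢ j → Disjoint H (e i) (e j)) →
    (∀ {i j} → i ≢ j → Anticomplete H (e i) (e j)) →
    copies n H ⊑ G
  disjointCopies {n} H e disjoint anticomplete =
    place ∘ remQuot {n} (order H) , remQuot-injective ∘ place-injective _ _ , preserves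
    where
    place : Fin n × Fin (order H) → V
    place (i , a) = proj₁ (e i) a

    remQuot-injective : ∀ {u v} → remQuot {n} (order H) u ≡ remQuot (order H) v → u ≡ v
    remQuot-injective {u} {v} eq =
      trans (sym (combine-remQuot {n} (order H) u))
            (trans (cong (uncurry combine) eq) (combine-remQuot {n} (order H) v))

    place-injective : ∀ x y → place x ≡ place y → x ≡ y
    place-injective (i , a) (j , b) eq with i Fin.≟ j
    ... | yes refl = cong (i ,_) (proj₁ (proj₂ (e i)) eq)
    ... | no  i≢j  = contradiction eq (disjoint i≢j a b)

    place-preserves : ∀ i j a b →
      does (i Fin.≟ j) ∧ adjacent H a b ≡ adj (place (i , a)) (place (j , b))
    place-preserves i j a b with i Fin.≟ j
    ... | yes refl = proj₂ (proj₂ (e i)) a b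
    ... | no  i≢j  = sym (anticomplete i≢j a b)

    preserves : ∀ u v → adjacent (copies n H) u v ≡
                        adj (place (remQuot {n} (order H) u)) (place (remQuot {n} (order H) v))
    preserves u v = place-preserves _ _ _ _

  -- Induced stars in a graph

  module _ (n : ℕ) where

    -- Position `zero` is the centre and the positions `suc i` are the leaves. The copy is induced,
    -- so the leaves are independent.
    Star : Set
    Star = K⟨ 1 , n ⟩ ⊑ G

    vertices : Star → List V
    vertices (f , _) = tabulate f

    AvoidedBy : List V → Star → Set
    AvoidedBy F s = All (_∉ F) (vertices s)

    -- Removing `F` leaves at least `ramseyNumber n n` neighbours of `v`. Among them Ramsey's
    -- theorem finds `n` that form a clique, which `noK` excludes, or `n` independent ones, which
    -- serve as leaves.
    starAt : ¬ K n ⊑ G → ∀ v F → v ∉ F → ramseyNumber n n + length F ≤ degree G v →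
             ∃[ s ] AvoidedBy F s
    starAt noK v F v∉F deg≥ = build (ramsey adj n n candidates enough)
      where
      candidates : List V
      candidates = satisfying (adj v) ∖ F

      candidates-unique : Unique candidates
      candidates-unique = filter⁺ _ (satisfying-unique (adj v))

      enough : ramseyNumber n n ≤ length candidates
      enough = +-cancelˡ-≤ (length F) _ _ (begin
        length F + ramseyNumber n n       ≡⟨ +-comm (length F) _ ⟩
        ramseyNumber n n + length F       ≤⟨ deg≥ ⟩
        degree G v                        ≡⟨ count-satisfying (adj v) ⟩
        length (satisfying (adj v))       ≤⟨ length-∖ F (satisfying-unique (adj v)) ⟩
        length F + length candidates      ∎)
        where open ≤-Reasoning

      build : MonochromaticSublist adj true n candidates ⊎ MonochromaticSublist adj false n candidates →
              ∃[ s ] AvoidedBy F s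
      build (inj₁ (ys , _ , n≤ , clique)) =
        contradiction (clique⇒K {f = select ys n≤} (AllPairs-select clique n≤)) noK
      build (inj₂ (ys , ys⊆ , n≤ , ind)) = star , v∉F ∷ All.tabulate avoids
        where
        leaf : Fin n → V
        leaf = select ys n≤

        leaf-∈ : ∀ i → leaf i ∈ satisfying (adj v) × leaf i ∉ F
        leaf-∈ i = ∈-filter⁻ _ (∈-resp-⊆ ys⊆ (select-∈ n≤ i))

        star : Star
        star = completeBipartite {f = const v} {g = leaf}
          (λ { {zero} {zero} _ → refl })
          (Unique⇒select-injective (AllPairs-resp-⊆ ys⊆ candidates-unique) n≤)
          (λ _ _ → irreflexive G v)
          (independent {f = leaf} (AllPairs-select ind n≤))
          (λ _ i → ∈-satisfying⁻ (adj v) (proj₁ (leaf-∈ i)))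

        avoids : ∀ {u} → u ∈ tabulate leaf → u ∉ F
        avoids u∈ with i , refl ← ∈-tabulate⁻ u∈ = proj₂ (leaf-∈ i)

    -- The first star has to avoid the remaining centres as well as F.
    disjointStars : ¬ K n ⊑ G → ∀ vs F → Unique vs → All (_∉ F) vs →
      All (λ v → ramseyNumber n n + (length F + length vs * suc n) ≤ degree G v) vs →
      ∃[ ss ] length ss ≡ length vs × AllPairs (Disjoint K⟨ 1 , n ⟩) ss × All (AvoidedBy F) ss
    disjointStars noK []       F _ _ _ = [] , refl , [] , []
    disjointStars noK (v ∷ vs) F vvs!@(_ ∷ vs!) (v∉F ∷ vs∉F) (deg ∷ degs) =
      s ∷ ss , cong suc len , All.map (λ {t} → disjoint {t}) avoids ∷ disj ,
      All.map (_∘ ∈-++⁺ʳ vs) avoid ∷ All.map (All.map (_∘ ∈-++⁺ʳ (vertices s))) avoids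
      where
      open ≤-Reasoning

      v∉ : v ∉ vs ++ F
      v∉ v∈ = [ Unique[x∷xs]⇒x∉xs vvs! , v∉F ]′ (∈-++⁻ vs v∈)

      starAt-v : ∃[ s ] AvoidedBy (vs ++ F) s
      starAt-v = starAt noK v (vs ++ F) v∉ (≤-trans (+-monoʳ-≤ (ramseyNumber n n) (begin
        length (vs ++ F)                         ≡⟨ length-++ vs ⟩
        length vs + length F                     ≡⟨ +-comm (length vs) (length F) ⟩
        -- The allowance of `suc n` vertices per star also pays for avoiding the remaining centres.
        length F + length vs                     ≤⟨ +-monoʳ-≤ (length F) (≤-trans (n≤1+n _) (m≤m*n _ (suc n))) ⟩
        length F + suc (length vs) * suc n       ∎)) deg)

      s = proj₁ starAt-v
      avoid = proj₂ starAt-v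

      -- The degree requirement is invariant: the new star adds `suc n` vertices to the forbidden
      -- list, and one star fewer remains to be placed.
      length≡ : length (vertices s ++ F) + length vs * suc n ≡ length F + suc (length vs) * suc n
      length≡ = begin-equality
        length (vertices s ++ F) + length vs * suc n
          ≡⟨ cong (_+ length vs * suc n) (length-++ (vertices s)) ⟩
        length (vertices s) + length F + length vs * suc n
          ≡⟨ cong (λ l → l + length F + length vs * suc n) (length-tabulate (proj₁ s)) ⟩
        suc n + length F + length vs * suc n
          ≡⟨ cong (_+ length vs * suc n) (+-comm (suc n) (length F)) ⟩
        length F + suc n + length vs * suc n
          ≡⟨ +-assoc (length F) (suc n) _ ⟩
        length F + suc (length vs) * suc n                    ∎

      -- The new star avoids the remaining centres, so they are still admissible for the enlarged
      -- forbidden list.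
      vs∉ : ∀ {w} → w ∈ vs → w ∉ vertices s ++ F
      vs∉ w∈vs w∈ = [ (λ w∈s → All.lookup avoid w∈s (∈-++⁺ˡ w∈vs)) , All.lookup vs∉F w∈vs ]′
                      (∈-++⁻ (vertices s) w∈)

      stars = disjointStars noK vs (vertices s ++ F) vs! (All.tabulate vs∉)
        (All.map (≤-trans (≤-reflexive (cong (ramseyNumber n n +_) length≡))) degs)

      ss = proj₁ stars
      len = proj₁ (proj₂ stars)
      disj = proj₁ (proj₂ (proj₂ stars))
      avoids = proj₂ (proj₂ (proj₂ stars))

      disjoint : ∀ {t} → AvoidedBy (vertices s ++ F) t → Disjoint K⟨ 1 , n ⟩ s t
      disjoint {t} t-avoids a b eq =
        All.lookup t-avoids (∈-tabulate⁺ {f = proj₁ t} b)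
          (∈-++⁺ˡ (subst (_∈ vertices s) eq (∈-tabulate⁺ {f = proj₁ s} a)))

    -- The colours `c a b` describe only pairs of stars in increasing order, so one block of stars
    -- would yield merely a half graph between positions `a` and `b`. With two blocks of `n` stars
    -- every left index precedes every right one, and the bipartite graph between the blocks is
    -- complete.
    uniformStars : (s : Fin (n + n) → Star) →
      (∀ {i j} → i ≢ j → Disjoint K⟨ 1 , n ⟩ (s i) (s j)) →
      (c : Fin (suc n) → Fin (suc n) → Bool) →
      (∀ {i j} → i Fin.< j → ∀ a b → adj (proj₁ (s i) a) (proj₁ (s j) b) ≡ c a b) →
      K n ⊑ G ⊎ K⟨ n , n ⟩ ⊑ G ⊎ copies n K⟨ 1 , n ⟩ ⊑ G
    uniformStars s disjoint c uniform = cases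
      where
      left right : Fin n → Fin (suc n) → V
      left  i = proj₁ (s (i ↑ˡ n))
      right i = proj₁ (s (n ↑ʳ i))

      left-uniform : ∀ {i j} → i Fin.< j → ∀ a b → adj (left i a) (left j b) ≡ c a b
      left-uniform {i} {j} i<j = uniform (subst₂ _<_ (sym (toℕ-↑ˡ i n)) (sym (toℕ-↑ˡ j n)) i<j)

      right-uniform : ∀ {i j} → i Fin.< j → ∀ a b → adj (right i a) (right j b) ≡ c a b
      right-uniform {i} {j} i<j =
        uniform (subst₂ _<_ (sym (toℕ-↑ʳ n i)) (sym (toℕ-↑ʳ n j)) (+-monoʳ-< n i<j))

      cross-uniform : ∀ i j a b → adj (left i a) (right j b) ≡ c a b
      cross-uniform i j = uniform
        (subst₂ _<_ (sym (toℕ-↑ˡ i n)) (sym (toℕ-↑ʳ n j)) (<-≤-trans (toℕ<n i) (m≤m+n n _)))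

      left-injective : ∀ a → Injective _≡_ _≡_ (λ i → left i a)
      left-injective a = ≢⇒injective (λ i → left i a) λ i≢j → disjoint (i≢j ∘ ↑ˡ-injective n _ _) a a

      right-injective : ∀ a → Injective _≡_ _≡_ (λ i → right i a)
      right-injective a = ≢⇒injective (λ i → right i a) λ i≢j → disjoint (i≢j ∘ ↑ʳ-injective n _ _) a a

      cases : K n ⊑ G ⊎ K⟨ n , n ⟩ ⊑ G ⊎ copies n K⟨ 1 , n ⟩ ⊑ G
      cases with any? (λ a → c a a Bool.≟ true)
      ... | yes (a , caa) = inj₁ (clique⇒K {f = λ i → left i a} λ i<j → trans (left-uniform i<j a a) caa)
      ... | no ¬diag with any? (λ a → any? (λ b → c a b Bool.≟ true))
      -- One side consists of the `a`-th vertices of the left stars, the other of the `b`-th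
      -- vertices of the right stars. Both are independent, since no diagonal colour is "adjacent".
      ...   | yes (a , b , cab) = inj₂ (inj₁ (completeBipartite (left-injective a) (right-injective b)
                (independent {f = λ i → left i a} λ i<j → trans (left-uniform i<j a a) (diag a))
                (independent {f = λ i → right i b} λ i<j → trans (right-uniform i<j b b) (diag b))
                (λ i j → trans (cross-uniform i j a b) cab)))
        where
        diag : ∀ a → c a a ≡ false
        diag a = Bool.¬-not λ eq → ¬diag (a , eq)
      ...   | no ¬c = inj₂ (inj₂ (disjointCopies K⟨ 1 , n ⟩ (λ i → s (i ↑ˡ n))
                (λ i≢j → disjoint (i≢j ∘ ↑ˡ-injective n _ _))
                -- Reversing a pair of stars exchanges the two positions; this is harmless as all
                -- colours are "non-adjacent".
                (offDiagonal {R = Anticomplete K⟨ 1 , n ⟩} (λ r a b → adjacent-sym (r b a)) (λ i → s (i ↑ˡ n))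
                  (λ i<j a b → trans (left-uniform i<j a b) (Bool.¬-not λ eq → ¬c (a , b , eq))))))

-- Bounding the number of vertices of high degree

starCount : ℕ → ℕ
starCount n = iteratedRamseyNumber (suc n * suc n) (n + n)

-- This is the degree that `disjointStars` demands of `starCount n` centres when nothing is
-- forbidden at the start.
degreeBound : ℕ → ℕ
degreeBound n = ramseyNumber n n + starCount n * suc n

highDegreeCount< : ∀ n G → ¬ K n ⊑ G → ¬ K⟨ n , n ⟩ ⊑ G → ¬ copies n K⟨ 1 , n ⟩ ⊑ G →
                   ∣ verticesOfDegree≥ (degreeBound n) G ∣ < starCount n
highDegreeCount< n G noK noKnn noStars = ≰⇒> impossible
  where
  high : Fin (order G) → Bool
  high v = does (degreeBound n ≤? degree G v)

  -- The index `p` encodes a pair of positions, so there are `suc n * suc n` colourings;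
  -- `combine a b` is the code of the pair `(a , b)`.
  colour : Fin (suc n * suc n) → Star G n → Star G n → Bool
  colour p s t = adjacent G (proj₁ s (proj₁ ab)) (proj₁ t (proj₂ ab))
    where ab = remQuot {suc n} (suc n) p

  module _ (many : starCount n ≤ ∣ verticesOfDegree≥ (degreeBound n) G ∣) where

    centres : List (Fin (order G))
    -- The degree demanded by `disjointStars` grows with the number of centres, so exactly
    -- `starCount n` of them are kept to match `degreeBound n`.
    centres = take (starCount n) (satisfying high)

    length-centres : length centres ≡ starCount n
    length-centres = trans (length-take (starCount n) (satisfying high))
      (m≤n⇒m⊓n≡m (≤-trans many (≤-reflexive (count-satisfying high))))

    centres⊆ : centres ⊆ satisfying high
    centres⊆ = take-⊆ (starCount n) (satisfying high)

    centres-unique : Unique centres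
    centres-unique = AllPairs-resp-⊆ centres⊆ (satisfying-unique high)

    centres-degree : All (λ v → ramseyNumber n n + length centres * suc n ≤ degree G v) centres
    centres-degree = All.tabulate λ {v} v∈ →
      subst (λ l → ramseyNumber n n + l * suc n ≤ degree G v) (sym length-centres)
        (does-true⇒ (_ ≤? degree G v) (∈-satisfying⁻ high (∈-resp-⊆ centres⊆ v∈)))

    impossible : ⊥
    impossible
      with ss , len , disj , _ ← disjointStars G n noK centres []
             centres-unique (All.tabulate λ _ ()) centres-degree
      with c , ys , ys⊆ss , 2n≤ , mono ← iteratedRamsey (suc n * suc n) colour (n + n) ss
             (≤-reflexive (sym (trans len length-centres)))
      = [ noK , [ noKnn , noStars ]′ ]′ (uniformStars G n (select ys 2n≤)
          (offDiagonal {R = Disjoint G K⟨ 1 , n ⟩} (λ r a b eq → r b a (sym eq)) (select ys 2n≤)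
            (AllPairs-select (AllPairs-resp-⊆ ys⊆ss disj) 2n≤))
          (λ a b → c (combine a b))
          (λ {i} {j} i<j a b → subst
            (λ ab → adjacent G (proj₁ (select ys 2n≤ i) (proj₁ ab)) (proj₁ (select ys 2n≤ j) (proj₂ ab))
                    ≡ c (combine a b))
            (remQuot-combine a b) (AllPairs-select (mono (combine a b)) 2n≤ i<j)))

-- Many vertices of high degree in the three unavoidable graphs

-- For each `i` the map `g i` exhibits `m` distinct neighbours of `f i`. Below, `f` picks all
-- vertices of the complete graph, one side of the bipartite graph, or the centres of the stars.
≤-highDegreeCount : ∀ {c} G {f : Fin k → Fin (order G)} → Injective _≡_ _≡_ f →
  (g : Fin k → Fin m → Fin (order G)) → (∀ i → Injective _≡_ _≡_ (g i)) →
  (∀ i j → adjacent G (f i) (g i j) ≡ true) → c ≤ m →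
  k ≤ ∣ verticesOfDegree≥ c G ∣
≤-highDegreeCount G {f} f-inj g g-inj edge c≤m = injection⇒≤-count _ f-inj λ i →
  dec-true (_ ≤? degree G (f i)) (≤-trans c≤m (injection⇒≤-count (adjacent G (f i)) (g-inj i) (edge i)))

K-highDegreeCount : ∀ {c} m → c ≤ m → suc m ≤ ∣ verticesOfDegree≥ c (K (suc m)) ∣
K-highDegreeCount m = ≤-highDegreeCount (K (suc m)) {id} id punchIn (λ i → punchIn-injective i _ _)
  λ i j → cong not (dec-false (i Fin.≟ punchIn i j) (punchInᵢ≢i i j ∘ sym))

Knn-highDegreeCount : ∀ {c} n → c ≤ n → n ≤ ∣ verticesOfDegree≥ c K⟨ n , n ⟩ ∣
Knn-highDegreeCount n = ≤-highDegreeCount K⟨ n , n ⟩ (↑ˡ-injective n _ _) (λ _ → n ↑ʳ_)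
  (λ _ → ↑ʳ-injective n _ _) edge
  where
  edge : ∀ i j → adjacent K⟨ n , n ⟩ (i ↑ˡ n) (n ↑ʳ j) ≡ true
  edge i j rewrite splitAt-↑ˡ n i n | splitAt-↑ʳ n n j = refl

stars-highDegreeCount : ∀ {c} n → c ≤ n → n ≤ ∣ verticesOfDegree≥ c (copies n K⟨ 1 , n ⟩) ∣
stars-highDegreeCount n = ≤-highDegreeCount (copies n K⟨ 1 , n ⟩)
  {λ i → combine i zero} (combine-injectiveˡ _ _ _ _)
  (λ i j → combine i (suc j)) (λ i eq → Fin.suc-injective (combine-injectiveʳ i _ i _ eq)) edge
  where
  edge : ∀ i j → adjacent (copies n K⟨ 1 , n ⟩) (combine i zero) (combine i (suc j)) ≡ true
  edge i j = trans (copies-adjacent K⟨ 1 , n ⟩ i zero i (suc j)) (cong (_∧ true) (dec-true (i Fin.≟ i) refl))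

-- Characterisation of the families that bound the number of high-degree vertices

theorem1p8 : ∀ {ℓ : Level} → ExcludedMiddle ℓ → (ℋ : Family ℓ) →
    (∃[ c₁ ] ∃[ c₂ ] ((G : Graph) → Free ℋ G → ∣ verticesOfDegree≥ c₁ G ∣ < c₂))
    ⇔
    (∃[ n ] n ≥ 1 × ℋ ≼ ⟦ K n ∷ K⟨ n , n ⟩ ∷ copies n K⟨ 1 , n ⟩ ∷ [] ⟧)
theorem1p8 em ℋ = mk⇔ bounded⇒≼ ≼⇒bounded
  where
  bounded⇒≼ : (∃[ c₁ ] ∃[ c₂ ] ((G : Graph) → Free ℋ G → ∣ verticesOfDegree≥ c₁ G ∣ < c₂)) →
              ∃[ n ] n ≥ 1 × ℋ ≼ ⟦ K n ∷ K⟨ n , n ⟩ ∷ copies n K⟨ 1 , n ⟩ ∷ [] ⟧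
  -- Degrees in `K n` are `n` minus one, so `n` is one more than `c₁ + c₂`. Then in all three graphs
  -- at least `c₂` vertices have degree at least `c₁`.
  bounded⇒≼ (c₁ , c₂ , bounded) = suc d , s≤s z≤n , λ where
      _ (here refl)                 → notFree (K (suc d)) (≤-trans c₂≤n (K-highDegreeCount d c₁≤d))
      _ (there (here refl))         → notFree K⟨ suc d , suc d ⟩ (≤-trans c₂≤n (Knn-highDegreeCount (suc d) c₁≤n))
      _ (there (there (here refl))) → notFree (copies (suc d) K⟨ 1 , suc d ⟩) (≤-trans c₂≤n (stars-highDegreeCount (suc d) c₁≤n))
    where
    d = c₁ + c₂
    c₁≤d = m≤m+n c₁ c₂
    c₁≤n = m≤n⇒m≤1+n c₁≤d
    c₂≤n = m≤n⇒m≤1+n (m≤n+m c₂ c₁)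

    notFree : ∀ G → c₂ ≤ ∣ verticesOfDegree≥ c₁ G ∣ → ∃[ H ] ℋ H × H ⊑ G
    -- The bound only refutes that `G` is free; excluded middle turns this into an actual member of
    -- `ℋ` inside `G`.
    notFree G c₂≤ = em⇒dne em λ free → <⇒≱ (bounded G free) c₂≤

  ≼⇒bounded : (∃[ n ] n ≥ 1 × ℋ ≼ ⟦ K n ∷ K⟨ n , n ⟩ ∷ copies n K⟨ 1 , n ⟩ ∷ [] ⟧) →
              ∃[ c₁ ] ∃[ c₂ ] ((G : Graph) → Free ℋ G → ∣ verticesOfDegree≥ c₁ G ∣ < c₂)
  ≼⇒bounded (n , _ , ℋ≼) = degreeBound n , starCount n , λ G free →
    -- Each of the three graphs contains a member of `ℋ`, so by transitivity a free graph contains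
    -- none of the three.
    let excluded : ∀ H → H ∈ K n ∷ K⟨ n , n ⟩ ∷ copies n K⟨ 1 , n ⟩ ∷ [] → ¬ H ⊑ G
        excluded H H∈ H⊑G = let H₁ , H₁∈ℋ , H₁⊑H = ℋ≼ H H∈ in
          free (H₁ , H₁∈ℋ , ⊑-trans {H₁} {H} {G} H₁⊑H H⊑G)
    in highDegreeCount< n G (excluded _ (here refl)) (excluded _ (there (here refl)))
                            (excluded _ (there (there (here refl))))
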